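{- The family of GAP-rich subsets of $\mathbb{N}$ is strongly partition regular: for every GAP-rich set $A\subseteq\mathbb{N}$ and every finite partition $A=A_1\cup\dots\cup A_m$ there is $i\leq m$ such that $A_i$ is GAP-rich.
   Context: A set $A\subseteq\mathbb{N}$ is GAP-rich (contains arbitrarily long geoarithmetic progressions) if for every $k\in\mathbb{N}$ there are $r,a,b\in\mathbb{N}$ with $r>1$ and $b>0$ such that $r^{i}(a+jb)\in A$ for all $1\leq i,j\leq k$. -}

module Defs where

open import Data.Fin.Base using (Fin)
open import Data.Nat.Base using (ℕ; _+_; _*_; _^_; _≤_; _>_)
open import Data.Product.Base using (_×_; ∃-syntax)
open import Level using (Level; 0ℓ)
open import Relation.Binary.PropositionalEquality.Core using (_≢_)
open import Relation.Unary using (Pred; _∈_; _≐_; _⊥_; ⋃)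

GAPRich : Pred (Pred ℕ 0ℓ) 0ℓ
GAPRich A =
  ∀ k → ∃[ r ] ∃[ a ] ∃[ b ] (r > 1 × b > 0 ×
    (∀ i j → 1 ≤ i → i ≤ k → 1 ≤ j → j ≤ k → r ^ i * (a + j * b) ∈ A))

-- Blocks of a partition are allowed to be empty; in particular m = 0 is
-- permitted, in which case A is empty.
record IsPartition (A : Pred ℕ 0ℓ) {m : ℕ} (As : Fin m → Pred ℕ 0ℓ) : Set where
  field
    covers   : A ≐ ⋃ (Fin m) As
    disjoint : ∀ {i j} → i ≢ j → As i ⊥ As j

StronglyPartitionRegular : ∀ {ℓ : Level} → Pred (Pred ℕ 0ℓ) ℓ → Set _
StronglyPartitionRegular F =
  ∀ (A : Pred ℕ 0ℓ) → A ∈ F →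
  ∀ (m : ℕ) (As : Fin m → Pred ℕ 0ℓ) → IsPartition A As →
  ∃[ i ] As i ∈ F

{-# OPTIONS --safe #-}
-- Van der Waerden's theorem, applied first to the rows of a finitely coloured
-- grid and then inside one row, yields a monochromatic subgrid
-- {(s + i d , t + j e) : 1 ≤ i, j ≤ k}.  Since
--   r ^ (s + i d) * (a + (t + j e) b)
--     = (r ^ d) ^ i * (r ^ s (a + t b) + j (r ^ s e b)),
-- a subgrid of a geoarithmetic progression is again one, so for every k some
-- block contains a progression of size k; by pigeonhole one block serves
-- infinitely many k.
module Submission where

open import Defs
open import Axiom.ExcludedMiddle using (ExcludedMiddle)
open import Data.Empty using (⊥-elim)
open import Data.Fin.Base as Fin using (Fin; zero; suc; fromℕ<; toℕ; funToFin; finToFun)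
import Data.Fin.Properties as Fin
open import Data.Nat.Base
open import Data.Nat.Properties
open import Data.Nat.Tactic.RingSolver using (solve-∀)
open import Data.Product.Base using (_×_; _,_; proj₁; proj₂; ∃-syntax)
open import Data.Sum.Base using (_⊎_; inj₁; inj₂; [_,_]′)
open import Function.Base using (_∘_; id)
open import Level using (0ℓ)
open import Relation.Binary.Core using (Rel)
open import Relation.Binary.PropositionalEquality
open import Relation.Nullary using (¬_; yes; no; contradiction)
open import Relation.Nullary.Decidable using (decidable-stable)
open import Relation.Unary using (Pred; _∈_)

private
  variable
    c k n N : ℕ

-- Arithmetic progressions of like-coloured points and of like-coloured rows.

-- The terms are base + j * diff for 1 ≤ j ≤ k; base itself is not a term.
record Progression (_~_ : Rel ℕ 0ℓ) (k N : ℕ) : Set where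
  field
    base diff : ℕ
    diff>0    : diff > 0
    bounded   : base + k * diff < N
    alike     : ∀ {j} → j < k → (base + suc j * diff) ~ (base + diff)

SameColour : (ℕ → Fin c) → Rel ℕ 0ℓ
SameColour χ x y = χ x ≡ χ y

SameRow : (ℕ → ℕ → Fin c) → ℕ → Rel ℕ 0ℓ
SameRow χ n s t = ∀ {x} → x < n → χ s x ≡ χ t x

VanDerWaerden : ℕ → Set
VanDerWaerden k = ∀ c → ∃[ N ] ∀ (χ : ℕ → Fin c) → Progression (SameColour χ) k N

-- A row cut to `n` cells has only `c ^ n` possible colourings, so its code serves as the colour of
-- the row index.
sameRowProgression : VanDerWaerden k → ∀ c n →
  ∃[ N ] ∀ (χ : ℕ → ℕ → Fin c) → Progression (SameRow χ n) k N
sameRowProgression vdw c n with N , prog ← vdw (c ^ n) = N , λ χ →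
  let open Progression (prog (code ∘ χ)) in record
    { base = base ; diff = diff ; diff>0 = diff>0 ; bounded = bounded
    ; alike = λ j<k → decode (alike j<k)
    }
  where
  open ≡-Reasoning
  code : (ℕ → Fin c) → Fin (c ^ n)
  code f = funToFin {n} (f ∘ toℕ)
  decode : ∀ {f g} → code f ≡ code g → ∀ {x} → x < n → f x ≡ g x
  decode {f} {g} eq {x} x<n = begin
    f x                    ≡⟨ cong f (Fin.toℕ-fromℕ< x<n) ⟨
    f (toℕ i)              ≡⟨ Fin.finToFun-funToFin (f ∘ toℕ) i ⟨
    finToFun (code f) i    ≡⟨ cong (λ z → finToFun z i) eq ⟩
    finToFun (code g) i    ≡⟨ Fin.finToFun-funToFin (g ∘ toℕ) i ⟩
    g (toℕ i)              ≡⟨ cong g (Fin.toℕ-fromℕ< x<n) ⟩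
    g x                    ∎
    where
    i = fromℕ< x<n

-- Colour focusing.

-- With `closed` the base becomes a further term: a monochromatic progression of `k + 1` terms.
record ClosedProgression (χ : ℕ → Fin c) (k N : ℕ) : Set where
  field
    progression : Progression (SameColour χ) k N
  open Progression progression public
  field
    closed : χ base ≡ χ (base + diff)

-- Differently coloured progressions sharing a base.  One of the differences
-- may be zero, so that the base itself counts as a colour.
record Fan (χ : ℕ → Fin c) (k s N : ℕ) : Set where
  field
    base    : ℕ
    diff    : Fin s → ℕ
    bounded : ∀ i → base + k * diff i < N
    alike   : ∀ i {j} → j < k → χ (base + suc j * diff i) ≡ χ (base + diff i)
    rainbow : ∀ {i j} → i Fin.< j → χ (base + diff i) ≢ χ (base + diff j)

-- One step of colour focusing.  Among consecutive blocks of length n, the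
-- blocks t + j e (1 ≤ j ≤ k + 1) are coloured alike.  A fan in block t + e,
-- moved to base block t with differences enlarged by e n, keeps its colours.
module Refocus {χ : ℕ → Fin c}
  (blocks : Progression (SameRow (λ t x → χ (t * n + x)) n) (suc k) N)
  where

  open Progression blocks renaming (base to t; diff to e; diff>0 to e>0)
  open ≤-Reasoning

  block : ℕ → Fin c
  block x = χ ((t + e) * n + x)

  block-bound : ∀ {x} → x < n → (t + suc k * e) * n + x < N * n
  block-bound {x} x<n = begin-strict
    (t + suc k * e) * n + x  <⟨ +-monoʳ-< ((t + suc k * e) * n) x<n ⟩
    (t + suc k * e) * n + n  ≡⟨ +-comm _ n ⟩
    suc (t + suc k * e) * n  ≤⟨ *-monoˡ-≤ n bounded ⟩
    N * n                    ∎

  widen : ClosedProgression block (suc k) n → ClosedProgression χ (suc k) (N * n)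
  widen p = record
    { progression = record
      { base = (t + e) * n + p.base ; diff = p.diff ; diff>0 = p.diff>0
      ; bounded = begin-strict
          (t + e) * n + p.base + suc k * p.diff
            ≡⟨ +-assoc ((t + e) * n) _ _ ⟩
          (t + e) * n + (p.base + suc k * p.diff)
            ≤⟨ +-monoˡ-≤ _ (*-monoˡ-≤ n (+-monoʳ-≤ t (m≤m+n e (k * e)))) ⟩
          (t + suc k * e) * n + (p.base + suc k * p.diff)
            <⟨ block-bound p.bounded ⟩
          N * n ∎
      ; alike = λ j<K → trans (assoc _) (trans (p.alike j<K) (sym (assoc _)))
      }
    ; closed = trans p.closed (sym (assoc _))
    }
    where
    module p = ClosedProgression p
    assoc : ∀ x → χ ((t + e) * n + p.base + x) ≡ block (p.base + x)
    assoc x = cong χ (+-assoc ((t + e) * n) p.base x)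

  module _ {s} (fan : Fan block (suc k) (suc s) n) where

    private module f = Fan fan

    base′ : ℕ
    base′ = t * n + f.base

    diff′ : Fin (suc (suc s)) → ℕ
    diff′ zero    = 0
    diff′ (suc i) = f.diff i + e * n

    shift : ∀ j i → base′ + j * diff′ (suc i) ≡ (t + j * e) * n + (f.base + j * f.diff i)
    shift j i = lemma t n f.base j (f.diff i) e
      where
      lemma : ∀ t n b j d e → t * n + b + j * (d + e * n) ≡ (t + j * e) * n + (b + j * d)
      lemma = solve-∀

    inside : ∀ i {j} → j < suc k → f.base + suc j * f.diff i < n
    inside i j<K = ≤-<-trans (+-monoʳ-≤ f.base (*-monoˡ-≤ (f.diff i) j<K)) (f.bounded i)

    bounded′ : ∀ i → base′ + suc k * diff′ i < N * n
    bounded′ (suc i) = subst (_< N * n) (sym (shift (suc k) i)) (block-bound (f.bounded i))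
    bounded′ zero    = begin-strict
      base′ + suc k * 0                 ≤⟨ +-monoʳ-≤ base′ (*-monoʳ-≤ (suc k) z≤n) ⟩
      base′ + suc k * diff′ (suc zero)  <⟨ bounded′ (suc zero) ⟩
      N * n                             ∎

    colour : ∀ i → χ (base′ + diff′ (suc i)) ≡ block (f.base + f.diff i)
    colour i = cong χ (lemma t n f.base (f.diff i) e)
      where
      lemma : ∀ t n b d e → t * n + b + (d + e * n) ≡ (t + e) * n + (b + d)
      lemma = solve-∀

    alike′ : ∀ i {j} → j < suc k → χ (base′ + suc j * diff′ i) ≡ χ (base′ + diff′ i)
    alike′ zero    {j} _   = cong (χ ∘ (base′ +_)) (*-zeroʳ j)
    alike′ (suc i) {j} j<K =
      -- Go from block `t + (j + 1) e` to block `t + e`, where the fan's own `alike` applies.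
      trans (cong χ (shift (suc j) i))
      (trans (alike j<K (inside i j<K))
      (trans (f.alike i j<K) (sym (colour i))))

    -- The old difference may be zero, but `e * n` is positive, since a fan fits below `n` only if
    -- `n > 0`.
    diff′>0 : ∀ i → diff′ (suc i) > 0
    diff′>0 i = begin-strict
      0                  <⟨ *-mono-< e>0 (m<n⇒0<n (f.bounded i)) ⟩
      e * n              ≤⟨ m≤n+m (e * n) (f.diff i) ⟩
      f.diff i + e * n   ∎

    -- Either the new base repeats the colour of some spoke and closes it, or its colour is new and
    -- it joins as the spoke of difference zero.
    refocus : ClosedProgression χ (suc k) (N * n) ⊎ Fan χ (suc k) (suc (suc s)) (N * n)
    refocus with Fin.any? (λ i → χ base′ Fin.≟ χ (base′ + diff′ (suc i)))
    ... | yes (i , eq) = inj₁ (record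
      { progression = record
        { base = base′ ; diff = diff′ (suc i) ; diff>0 = diff′>0 i
        ; bounded = bounded′ (suc i) ; alike = alike′ (suc i)
        }
      ; closed = eq
      })
    ... | no distinct = inj₂ (record
      { base = base′ ; diff = diff′ ; bounded = bounded′ ; alike = alike′ ; rainbow = rainbow′ })
      where
      rainbow′ : ∀ {i j} → i Fin.< j → χ (base′ + diff′ i) ≢ χ (base′ + diff′ j)
      rainbow′ {zero}  {suc j} _         eq = distinct (j , trans (cong χ (sym (+-identityʳ base′))) eq)
      rainbow′ {suc i} {suc j} (s<s i<j) eq = f.rainbow i<j (trans (sym (colour i)) (trans eq (colour j)))

-- Induction on `s`: `outer` finds blocks of length `n` coloured alike, and `inner` searches one of
-- them. A closed progression there is kept; a fan gains one colour.
closedProgressionOrFan : VanDerWaerden (suc k) → ∀ c s →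
  ∃[ N ] ∀ (χ : ℕ → Fin c) → ClosedProgression χ (suc k) N ⊎ Fan χ (suc k) (suc s) N
-- The point 0 with a single difference zero is a fan of one colour.
closedProgressionOrFan {k} vdw c zero = 1 , λ χ → inj₂ (record
  { base = 0 ; diff = λ _ → 0
  ; bounded = λ _ → s≤s (≤-reflexive (*-zeroʳ k))
  ; alike = λ _ {j} _ → cong χ (*-zeroʳ j)
  ; rainbow = λ { {zero} {zero} () }
  })
closedProgressionOrFan vdw c (suc s)
  with n , inner ← closedProgressionOrFan vdw c s
  with N , outer ← sameRowProgression vdw c n
  = N * n , λ χ → let open Refocus {χ = χ} (outer (λ t x → χ (t * n + x))) in
      [ inj₁ ∘ widen , refocus ]′ (inner block)

-- After `c` focusing steps a fan would show `c + 1` distinct colours among `c`.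
closedProgression : VanDerWaerden (suc k) → ∀ c →
  ∃[ N ] ∀ (χ : ℕ → Fin c) → ClosedProgression χ (suc k) N
closedProgression {k} vdw c with N , h ← closedProgressionOrFan vdw c c =
  N , λ χ → [ id , ⊥-elim ∘ tooManyColours ]′ (h χ)
  where
  tooManyColours : ∀ {χ : ℕ → Fin c} → ¬ Fan χ (suc k) (suc c) N
  tooManyColours {χ} fan =
    let open Fan fan
        i , j , i<j , eq = Fin.pigeonhole (n<1+n c) (λ i → χ (base + diff i))
    in rainbow i<j eq

-- Van der Waerden's theorem by induction on the length.

vanDerWaerden-suc : VanDerWaerden (suc k) → VanDerWaerden (suc (suc k))
vanDerWaerden-suc {k} vdw c with N , h ← closedProgression vdw c =
  N + N , λ χ → prepend χ (h (λ x → χ (x + N)))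
  where
  -- A closed progression has one more term, its base; the translation by N
  -- leaves room for a new base below it.
  prepend : ∀ χ → ClosedProgression (λ x → χ (x + N)) (suc k) N →
            Progression (SameColour χ) (suc (suc k)) (N + N)
  prepend χ p = record
    { base = newBase ; diff = diff ; diff>0 = diff>0
    ; bounded = begin-strict
        newBase + (diff + suc k * diff)  ≡⟨ term (suc k) ⟩
        base + suc k * diff + N          <⟨ +-monoˡ-< N bounded ⟩
        N + N                            ∎
    ; alike = λ {j} j<K → trans (cong χ (term j)) (trans (toBase j j<K) (cong χ (sym newBase+diff)))
    }
    where
    open ClosedProgression p
    open ≤-Reasoning
    newBase = base + N ∸ diff
    diff≤ : diff ≤ base + N
    diff≤ = begin
      diff                 ≤⟨ m≤m+n diff (k * diff) ⟩
      suc k * diff         ≤⟨ m≤n+m (suc k * diff) base ⟩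
      base + suc k * diff  <⟨ bounded ⟩
      N                    ≤⟨ m≤n+m N base ⟩
      base + N             ∎
    newBase+diff : newBase + diff ≡ base + N
    newBase+diff = m∸n+n≡m diff≤
    term : ∀ j → newBase + suc j * diff ≡ base + j * diff + N
    term j = begin-equality
      newBase + (diff + j * diff)  ≡⟨ +-assoc newBase diff (j * diff) ⟨
      newBase + diff + j * diff    ≡⟨ cong (_+ j * diff) newBase+diff ⟩
      base + N + j * diff          ≡⟨ lemma base N (j * diff) ⟩
      base + j * diff + N          ∎
      where
      lemma : ∀ b N x → b + N + x ≡ b + x + N
      lemma = solve-∀
    toBase : ∀ j → j < suc (suc k) → χ (base + j * diff + N) ≡ χ (base + N)
    toBase zero    _         = cong (λ x → χ (x + N)) (+-identityʳ base)
    toBase (suc j) (s<s j<K) = trans (alike j<K) (sym closed)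

vanDerWaerden : ∀ k → VanDerWaerden (suc k)
vanDerWaerden zero    c = 2 , λ χ → record
  { base = 0 ; diff = 1 ; diff>0 = s≤s z≤n ; bounded = s≤s (s≤s z≤n)
  ; alike = λ { {zero} _ → refl ; {suc _} (s≤s ()) }
  }
vanDerWaerden (suc k) = vanDerWaerden-suc (vanDerWaerden k)

-- Monochromatic subgrids.

record Subgrid (χ : ℕ → ℕ → Fin c) (k N : ℕ) : Set where
  field
    s d t e       : ℕ
    d>0           : d > 0
    e>0           : e > 0
    row-bounded   : s + k * d < N
    col-bounded   : t + k * e < N
    colour        : Fin c
    monochromatic : ∀ {i j} → i < k → j < k → χ (s + suc i * d) (t + suc j * e) ≡ colour

-- The chosen rows agree on the first `M` columns, so a progression of columns found in the first
-- chosen row has the same colour in all of them.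
monochromaticSubgrid : ∀ k c → ∃[ N ] ∀ (χ : ℕ → ℕ → Fin c) → Subgrid χ (suc k) N
monochromaticSubgrid k c
  with M , inRow ← vanDerWaerden k c
  with N , ofRows ← sameRowProgression (vanDerWaerden k) c M
  = N ⊔ M , λ χ →
    let module R = Progression (ofRows χ)
        module C = Progression (inRow (χ (R.base + R.diff)))
    in record
      { s = R.base ; d = R.diff ; t = C.base ; e = C.diff ; d>0 = R.diff>0 ; e>0 = C.diff>0
      ; row-bounded = m<n⇒m<n⊔o M R.bounded
      ; col-bounded = m<n⇒m<o⊔n N C.bounded
      ; colour = χ (R.base + R.diff) (C.base + C.diff)
      ; monochromatic = λ i<k j<k → trans
          (R.alike i<k (≤-<-trans (+-monoʳ-≤ C.base (*-monoˡ-≤ C.diff j<k)) C.bounded))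
          (C.alike j<k)
      }

-- Geoarithmetic progressions inside a block.

-- `GAPRich A` unfolds to `∀ k → GAPOfSize k A`; isolating one size lets a block be chosen first for
-- each `k` and then uniformly.
GAPOfSize : ℕ → Pred (Pred ℕ 0ℓ) 0ℓ
GAPOfSize k A = ∃[ r ] ∃[ a ] ∃[ b ] (r > 1 × b > 0 ×
  (∀ i j → 1 ≤ i → i ≤ k → 1 ≤ j → j ≤ k → r ^ i * (a + j * b) ∈ A))

gapOfSize-antitone : ∀ {k l} (A : Pred ℕ 0ℓ) → k ≤ l → GAPOfSize l A → GAPOfSize k A
gapOfSize-antitone A k≤l (r , a , b , r>1 , b>0 , mem) = r , a , b , r>1 , b>0 ,
  λ i j 1≤i i≤k 1≤j j≤k → mem i j 1≤i (≤-trans i≤k k≤l) 1≤j (≤-trans j≤k k≤l)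

subgrid-term : ∀ r a b s d t e i j →
  r ^ (s + i * d) * (a + (t + j * e) * b) ≡
  (r ^ d) ^ i * (r ^ s * (a + t * b) + j * (r ^ s * (e * b)))
subgrid-term r a b s d t e i j = begin
  r ^ (s + i * d) * (a + (t + j * e) * b)
    ≡⟨ cong (_* (a + (t + j * e) * b)) (^-distribˡ-+-* r s (i * d)) ⟩
  r ^ s * r ^ (i * d) * (a + (t + j * e) * b)
    ≡⟨ cong (λ x → r ^ s * r ^ x * (a + (t + j * e) * b)) (*-comm i d) ⟩
  r ^ s * r ^ (d * i) * (a + (t + j * e) * b)
    ≡⟨ cong (λ x → r ^ s * x * (a + (t + j * e) * b)) (^-*-assoc r d i) ⟨
  r ^ s * (r ^ d) ^ i * (a + (t + j * e) * b)
    ≡⟨ lemma (r ^ s) ((r ^ d) ^ i) a b t e j ⟩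
  (r ^ d) ^ i * (r ^ s * (a + t * b) + j * (r ^ s * (e * b))) ∎
  where
  open ≡-Reasoning
  lemma : ∀ p q a b t e j →
    p * q * (a + (t + j * e) * b) ≡ q * (p * (a + t * b) + j * (p * (e * b)))
  lemma = solve-∀

-- Clamping indices into [1, N + 1] extends the colouring of a finite
-- geoarithmetic progression to all of ℕ × ℕ.
clamp : ℕ → ℕ → ℕ
clamp N i = 1 ⊔ (i ⊓ suc N)

1≤clamp : ∀ N i → 1 ≤ clamp N i
1≤clamp N i = m≤m⊔n 1 (i ⊓ suc N)

clamp≤ : ∀ N i → clamp N i ≤ suc N
clamp≤ N i = ⊔-lub (s≤s z≤n) (m⊓n≤n i (suc N))

clamp-inside : ∀ {N i} → 1 ≤ i → i ≤ suc N → clamp N i ≡ i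
clamp-inside {N} {i} 1≤i i≤ = begin
  1 ⊔ (i ⊓ suc N)  ≡⟨ cong (1 ⊔_) (m≤n⇒m⊓n≡m i≤) ⟩
  1 ⊔ i            ≡⟨ m≤n⇒m⊔n≡n 1≤i ⟩
  i                ∎
  where open ≡-Reasoning

-- Colour the index pair `(i , j)` of a large progression in `A` by a block containing its term; a
-- monochromatic subgrid is then a progression inside that block.
gapInBlock : ∀ {m} (A : Pred ℕ 0ℓ) (As : Fin m → Pred ℕ 0ℓ) →
  A ∈ GAPRich → (∀ x → x ∈ A → ∃[ i ] x ∈ As i) → ∀ k →
  ∃[ i ] As i ∈ GAPOfSize (suc k)
gapInBlock {m} A As rich cover k
  with N , subgrid ← monochromaticSubgrid k m
  -- Size `suc N` keeps the index range nonempty for every `N`, so clamping always lands in it.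
  with r , a , b , r>1 , b>0 , mem ← rich (suc N)
  = colour , r ^ d , r ^ s * (a + t * b) , r ^ s * (e * b)
  , ^-monoʳ-< r r>1 d>0
  , *-mono-< (m^n>0 r {{>-nonZero (<-trans z<s r>1)}} s) (*-mono-< e>0 b>0)
  , λ { (suc i) (suc j) _ i<k _ j<k →
        -- From the inside out: the term lies in the block of its own colour, that colour is the
        -- common one, the clamps vanish on the subgrid, and the term is rewritten with the new
        -- ratio.
        subst (_∈ As colour) (subgrid-term r a b s d t e (suc i) (suc j))
        (subst₂ (λ x y → r ^ x * (a + y * b) ∈ As colour)
          (inRange s d>0 row-bounded i<k) (inRange t e>0 col-bounded j<k)
        (subst (λ l → r ^ clamp N (s + suc i * d) * (a + clamp N (t + suc j * e) * b) ∈ As l)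
          (monochromatic i<k j<k)
          (proj₂ (block (s + suc i * d) (t + suc j * e))))) }
  where
  block : ∀ i j → ∃[ l ] r ^ clamp N i * (a + clamp N j * b) ∈ As l
  block i j = cover _ (mem _ _ (1≤clamp N i) (clamp≤ N i) (1≤clamp N j) (clamp≤ N j))
  open Subgrid (subgrid (λ i j → proj₁ (block i j)))
  inRange : ∀ u {v i} → v > 0 → u + suc k * v < N → i < suc k → clamp N (u + suc i * v) ≡ u + suc i * v
  inRange u {v} {i} v>0 bound i<k = clamp-inside
    (≤-trans v>0 (≤-trans (m≤m+n v (i * v)) (m≤n+m (suc i * v) u)))
    (m≤n⇒m≤1+n (<⇒≤ (≤-<-trans (+-monoʳ-≤ u (*-monoˡ-≤ v i<k)) bound)))

-- From one block for each size to one block for all sizes.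

-- If the first index fails at some `k₀`, it fails at every larger size, so asking at `k ⊔ k₀`
-- forces an answer among the remaining indices, and induction on `m` applies.
persistentIndex : ExcludedMiddle 0ℓ → ∀ {m} (P : Fin m → ℕ → Set) →
  (∀ i {k l} → k ≤ l → P i l → P i k) → (∀ k → ∃[ i ] P i k) → ∃[ i ] ∀ k → P i k
persistentIndex em {zero}  P antitone some with () ← proj₁ (some 0)
persistentIndex em {suc m} P antitone some with em {∃[ k ] ¬ P zero k}
... | no none = zero , λ k → decidable-stable em (λ ¬p → none (k , ¬p))
... | yes (k₀ , ¬p) =
  let i , always = persistentIndex em (P ∘ suc) (antitone ∘ suc) later in suc i , always
  where
  later : ∀ k → ∃[ i ] P (suc i) k
  later k with some (k ⊔ k₀)
  ... | zero  , p = contradiction (antitone zero (m≤n⊔m k k₀) p) ¬p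
  ... | suc i , p = i , antitone (suc i) (m≤m⊔n k k₀) p

proposition6p11 : ExcludedMiddle 0ℓ → StronglyPartitionRegular GAPRich
proposition6p11 em A rich m As partition =
  persistentIndex em (λ i k → As i ∈ GAPOfSize k) (λ i → gapOfSize-antitone (As i))
    -- `gapInBlock` yields size `suc k`, which is then cut down to `k`; this also covers `k = 0`.
    λ k → let i , gap = gapInBlock A As rich (λ _ → proj₁ covers) k in i , gapOfSize-antitone (As i) (n≤1+n k) gap
  where open IsPartition partition
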